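{- There exists a balanced group divisible triangle design $(V,\mathcal{G},\mathcal{B})$ of order $6$ with groups of dimension $2$ over $\mathbb{F}_2$, where $V=\mathbb{F}_{2^6}$ and $\mathcal{G}$ is the set of all $21$ one-dimensional $\mathbb{F}_{4}$-subspaces of $V$ (each a $2$-dimensional $\mathbb{F}_2$-subspace; i.e. the Desarguesian spread).
   Context: For a vector space $V$ over $\mathbb{F}_q$, a triangle is a set $\{\langle a,b\rangle,\langle b,c\rangle,\langle c,a\rangle\}$ of three $2$-dimensional subspaces, with $a,b,c$ linearly independent. For $m\mid n$, a group divisible triangle design of order $n$ with groups of dimension $m$ over $\mathbb{F}_q$ is a triple $(V,\mathcal{G},\mathcal{B})$: $V$ an $n$-dimensional $\mathbb{F}_q$-space, $\mathcal{G}$ a set of $m$-dimensional subspaces such that every nonzero vector lies in exactly one, and $\mathcal{B}$ a set of triangles such that every $2$-dimensional subspace either belongs to exactly one triangle of $\mathcal{B}$ and to no group, or to no triangle and to one group. A triangle covers a nonzero vector $x$ if $x$ lies in one of its three subspaces; the design is balanced if all nonzero vectors are covered by the same number of triangles of $\mathcal{B}$. -}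

module Defs where

open import Data.Bool using (Bool; true; false; _xor_; if_then_else_)
open import Data.Bool.Properties using () renaming (_≟_ to _≟B_)
open import Data.Nat using (ℕ; zero; suc)
open import Data.Fin using (Fin)
open import Data.Vec using (Vec; []; _∷_; replicate; zipWith)
open import Data.Vec.Properties using (≡-dec)
open import Data.List using (List; length; lookup; filter)
open import Data.Product using (Σ; _×_; _,_)
open import Data.Sum using (_⊎_)
open import Relation.Nullary using (¬_; Dec)
open import Relation.Nullary.Decidable using (_⊎-dec_)
open import Relation.Binary.PropositionalEquality using (_≡_; _≢_)
open import Function.Bundles using (_⇔_)

-- The field F_{2^6} = F_2[x]/(x^6 + x + 1)  (x^6+x+1 is primitive over F_2).
-- An element is its coefficient vector (c0,...,c5), c_i = coefficient of x^i.
-- As an F_2-vector space this is V = F_2^6, addition = coordinatewise xor.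

V : Set
V = Vec Bool 6

0v : V
0v = replicate 6 false

infixl 6 _⊕_
_⊕_ : V → V → V
_⊕_ = zipWith _xor_

_≟V_ : (u v : V) → Dec (u ≡ v)
_≟V_ = ≡-dec _≟B_

-- multiplication by x, reducing with x^6 = x + 1
mulX : V → V
mulX (v0 ∷ v1 ∷ v2 ∷ v3 ∷ v4 ∷ v5 ∷ []) = v5 ∷ (v0 xor v5) ∷ v1 ∷ v2 ∷ v3 ∷ v4 ∷ []

scale : Bool → V → V
scale b v = if b then v else 0v

mulAux : ∀ {n} → Vec Bool n → V → V
mulAux []       b = 0v
mulAux (a ∷ as) b = scale a b ⊕ mulX (mulAux as b)

infixl 7 _·_
_·_ : V → V → V
a · b = mulAux a b

InF4 : V → Set
InF4 λ' = (λ' · λ') · (λ' · λ') ≡ λ'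

F4Line : V → V → Set
F4Line v z = Σ V (λ λ' → InF4 λ' × z ≡ λ' · v)

LinIndep3 : V → V → V → Set
LinIndep3 a b c = (e₁ e₂ e₃ : Bool) →
  scale e₁ a ⊕ scale e₂ b ⊕ scale e₃ c ≡ 0v →
  (e₁ ≡ false) × (e₂ ≡ false) × (e₃ ≡ false)

LinIndep2 : V → V → Set
LinIndep2 a b = (e₁ e₂ : Bool) →
  scale e₁ a ⊕ scale e₂ b ≡ 0v → (e₁ ≡ false) × (e₂ ≡ false)

InSpan : V → V → V → Set
InSpan a b z = (z ≡ 0v) ⊎ (z ≡ a) ⊎ (z ≡ b) ⊎ (z ≡ a ⊕ b)

inSpan? : (a b z : V) → Dec (InSpan a b z)
inSpan? a b z = (z ≟V 0v) ⊎-dec ((z ≟V a) ⊎-dec ((z ≟V b) ⊎-dec (z ≟V (a ⊕ b))))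

SameSubspace : (V → Set) → (V → Set) → Set
SameSubspace S T = (z : V) → S z ⇔ T z

-- Triangles: a triangle is given by a triple (a , b , c) of linearly
-- independent vectors; its subspaces are ⟨a,b⟩, ⟨b,c⟩, ⟨c,a⟩.

Triple : Set
Triple = V × V × V

ValidTriangle : Triple → Set
ValidTriangle (a , b , c) = LinIndep3 a b c

TriContains : (V → Set) → Triple → Set
TriContains S (a , b , c) =
  SameSubspace S (InSpan a b) ⊎ SameSubspace S (InSpan b c) ⊎ SameSubspace S (InSpan c a)

Covers : V → Triple → Set
Covers x (a , b , c) = InSpan a b x ⊎ InSpan b c x ⊎ InSpan c a x

covers? : (x : V) → (t : Triple) → Dec (Covers x t)
covers? x (a , b , c) = inSpan? a b x ⊎-dec (inSpan? b c x ⊎-dec inSpan? c a x)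

coverCount : List Triple → V → ℕ
coverCount B x = length (filter (covers? x) B)

ExactlyOne : {A : Set} → (A → Set) → List A → Set
ExactlyOne {A} P xs = Σ (Fin (length xs)) (λ i →
  P (lookup xs i) × ((j : Fin (length xs)) → P (lookup xs j) → j ≡ i))

NoneOf : {A : Set} → (A → Set) → List A → Set
NoneOf P xs = (j : Fin (length xs)) → ¬ P (lookup xs j)

All : {A : Set} → (A → Set) → List A → Set
All P xs = (j : Fin (length xs)) → P (lookup xs j)

InGroupSet : (V → Set) → Set
InGroupSet S = Σ V (λ v → v ≢ 0v × SameSubspace S (F4Line v))

IsSpread : Set
IsSpread =
  ((v : V) → v ≢ 0v → Σ V (λ a → Σ V (λ b →
      LinIndep2 a b × SameSubspace (F4Line v) (InSpan a b))))
  × ((x : V) → x ≢ 0v → Σ V (λ v → v ≢ 0v × F4Line v x ×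
      ((w : V) → w ≢ 0v → F4Line w x → SameSubspace (F4Line w) (F4Line v))))

-- (V, 𝒢, B) is a group divisible triangle design: every triple in B is a
-- triangle, and every 2-dim subspace ⟨x,y⟩ lies in exactly one triangle of B
-- and in no group, or in no triangle and in a (necessarily unique) group.
IsGDTD : List Triple → Set
IsGDTD B =
  All ValidTriangle B
  × ((x y : V) → LinIndep2 x y →
       (ExactlyOne (TriContains (InSpan x y)) B × ¬ InGroupSet (InSpan x y))
     ⊎ (NoneOf (TriContains (InSpan x y)) B × InGroupSet (InSpan x y)))

Balanced : List Triple → Set
Balanced B = Σ ℕ (λ r → (x : V) → x ≢ 0v → coverCount B x ≡ r)

{-# OPTIONS --safe #-}

-- The elements α^{3s} of F_{64}^* (α = x) act on the 630 two-dimensional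
-- subspaces outside the Desarguesian spread with 30 orbits of length 21.  Ten
-- base triangles meet each of these orbits exactly once, so their 210 multiples
-- form the block set; they are chosen so that each of the three orbits of
-- nonzero vectors is covered equally often, which makes the design balanced.
--
-- A subspace is handled through its ordered bases, so that everything reduces to
-- an index sending an ordered basis to the block that contains its span.
module Submission where

open import Defs
open import Data.Bool using (Bool; true; false)
open import Data.Bool.Properties using (xor-assoc; xor-comm; xor-identityˡ; xor-identityʳ)
  renaming (_≟_ to _≟B_)
open import Data.Fin using (Fin)
import Data.Fin.Properties as Fin
open import Data.List using (List; []; _∷_; _++_; length; lookup; foldr; map; concatMap; upTo; allFin)
open import Data.List.Membership.Propositional using (_∈_)
open import Data.List.Membership.Propositional.Properties using (∈-++⁺ˡ; ∈-++⁺ʳ; ∈-++⁻)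
import Data.List.Membership.DecPropositional as DecMembership
import Data.List.Relation.Unary.All as ListAll
open import Data.List.Relation.Unary.Any using (here; there)
open import Data.Maybe using (Maybe; just; nothing)
import Data.Maybe.Properties as Maybe
open import Data.Nat using (ℕ; zero; suc; _+_; _*_)
import Data.Nat.Properties as ℕ
open import Data.Nat.GeneralisedArithmetic using (iterate)
open import Data.Product using (Σ; _×_; _,_; proj₁; proj₂)
open import Data.Product.Properties using () renaming (≡-dec to ×-≡-dec)
open import Data.Sum using (_⊎_; inj₁; inj₂)
open import Data.Vec using (Vec; []; _∷_) renaming (_++_ to _++ᵛ_)
open import Data.Vec.Properties
  using (zipWith-assoc; zipWith-comm; zipWith-identityˡ; zipWith-identityʳ)
open import Function using (_∘_; id)
open import Function.Bundles using (mk⇔; Equivalence)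
open import Relation.Binary.Definitions using (DecidableEquality)
open import Relation.Binary.PropositionalEquality
  using (_≡_; _≢_; refl; sym; trans; cong; subst; module ≡-Reasoning)
open import Relation.Nullary using (¬_; Dec; contradiction)
open import Relation.Nullary.Decidable using (map′; _×-dec_; _⊎-dec_; _→-dec_; ¬?; toWitness)
open import Relation.Unary using (Decidable)

open Equivalence using (to; from)

-- Exhaustive decision over bit vectors

-- Branching on the first bit visits all vectors. With `toWitness`, a decidable claim about every
-- element of `V` becomes a check of 64 cases.
∀Vec? : ∀ {n} {P : Vec Bool n → Set} → Decidable P → Dec (∀ v → P v)
∀Vec? {zero}  P? = map′ (λ { p [] → p }) (λ p → p []) (P? [])
∀Vec? {suc n} P? =
  map′ (λ { (f , t) (false ∷ v) → f v ; (f , t) (true ∷ v) → t v })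
       (λ p → (λ v → p (false ∷ v)) , (λ v → p (true ∷ v)))
       (∀Vec? (λ v → P? (false ∷ v)) ×-dec ∀Vec? (λ v → P? (true ∷ v)))

∀Bool? : {P : Bool → Set} → Decidable P → Dec (∀ b → P b)
∀Bool? P? =
  map′ (λ { (f , t) false → f ; (f , t) true → t }) (λ p → p false , p true)
       (P? false ×-dec P? true)

-- Addition in characteristic two

⊕-comm : ∀ u v → u ⊕ v ≡ v ⊕ u
⊕-comm = zipWith-comm xor-comm

⊕-identityˡ : ∀ v → 0v ⊕ v ≡ v
⊕-identityˡ = zipWith-identityˡ xor-identityˡ

⊕-identityʳ : ∀ v → v ⊕ 0v ≡ v
⊕-identityʳ = zipWith-identityʳ xor-identityʳ

⊕-self : ∀ v → v ⊕ v ≡ 0v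
⊕-self = toWitness {a? = ∀Vec? (λ v → (v ⊕ v) ≟V 0v)} _

⊕-cancelˡ : ∀ u v → u ⊕ (u ⊕ v) ≡ v
⊕-cancelˡ u v = begin
  u ⊕ (u ⊕ v)  ≡⟨ zipWith-assoc xor-assoc u u v ⟨
  (u ⊕ u) ⊕ v  ≡⟨ cong (_⊕ v) (⊕-self u) ⟩
  0v ⊕ v       ≡⟨ ⊕-identityˡ v ⟩
  v            ∎
  where open ≡-Reasoning

-- Two-dimensional subspaces and their ordered bases

module _ {S T : V → Set} where
  SameSubspace-sym : SameSubspace S T → SameSubspace T S
  SameSubspace-sym h z = mk⇔ (from (h z)) (to (h z))

  SameSubspace-trans : {U : V → Set} → SameSubspace S T → SameSubspace T U → SameSubspace S U
  SameSubspace-trans h k z = mk⇔ (to (k z) ∘ to (h z)) (from (h z) ∘ from (k z))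

SameSubspace-refl : {S : V → Set} → SameSubspace S S
SameSubspace-refl z = mk⇔ id id

InSpan-swap : ∀ a b → SameSubspace (InSpan a b) (InSpan b a)
InSpan-swap a b z = mk⇔ (swap a b) (swap b a)
  where
  swap : ∀ a b → InSpan a b z → InSpan b a z
  swap a b (inj₁ z≡0)                   = inj₁ z≡0
  swap a b (inj₂ (inj₁ z≡a))            = inj₂ (inj₂ (inj₁ z≡a))
  swap a b (inj₂ (inj₂ (inj₁ z≡b)))     = inj₂ (inj₁ z≡b)
  swap a b (inj₂ (inj₂ (inj₂ z≡a⊕b)))   = inj₂ (inj₂ (inj₂ (trans z≡a⊕b (⊕-comm a b))))

InSpan-shear : ∀ a b → SameSubspace (InSpan a b) (InSpan a (a ⊕ b))
InSpan-shear a b z = mk⇔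
  (λ { (inj₁ z≡0)                 → inj₁ z≡0
     ; (inj₂ (inj₁ z≡a))          → inj₂ (inj₁ z≡a)
     ; (inj₂ (inj₂ (inj₁ z≡b)))   → inj₂ (inj₂ (inj₂ (trans z≡b (sym (⊕-cancelˡ a b)))))
     ; (inj₂ (inj₂ (inj₂ z≡a⊕b))) → inj₂ (inj₂ (inj₁ z≡a⊕b)) })
  (λ { (inj₁ z≡0)                 → inj₁ z≡0
     ; (inj₂ (inj₁ z≡a))          → inj₂ (inj₁ z≡a)
     ; (inj₂ (inj₂ (inj₁ z≡a⊕b))) → inj₂ (inj₂ (inj₂ z≡a⊕b))
     ; (inj₂ (inj₂ (inj₂ z≡b)))   → inj₂ (inj₂ (inj₁ (trans z≡b (⊕-cancelˡ a b)))) })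

-- A plane over F_2 has three nonzero vectors, any two of them independent, hence six ordered bases.
-- Listing them turns equality of planes into decidable list membership.
orderedBases : V → V → List (V × V)
orderedBases a b =
  (a , b) ∷ (b , a) ∷ (a , a ⊕ b) ∷ (a ⊕ b , a) ∷ (b , a ⊕ b) ∷ (a ⊕ b , b) ∷ []

∈-orderedBases⇒SameSubspace : ∀ {a b x y} → (x , y) ∈ orderedBases a b →
  SameSubspace (InSpan x y) (InSpan a b)
∈-orderedBases⇒SameSubspace {a} {b} = SameSubspace-sym ∘ go
  where
  -- The shear of the swapped basis yields `b ⊕ a`, which `subst` rewrites to `a ⊕ b`.
  reversed : SameSubspace (InSpan a b) (InSpan b (a ⊕ b))
  reversed = subst (λ s → SameSubspace (InSpan a b) (InSpan b s)) (⊕-comm b a)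
               (SameSubspace-trans (InSpan-swap a b) (InSpan-shear b a))

  go : ∀ {x y} → (x , y) ∈ orderedBases a b → SameSubspace (InSpan a b) (InSpan x y)
  go (here refl) = SameSubspace-refl
  go (there (here refl)) = InSpan-swap a b
  go (there (there (here refl))) = InSpan-shear a b
  go (there (there (there (here refl)))) =
    SameSubspace-trans (InSpan-shear a b) (InSpan-swap a (a ⊕ b))
  go (there (there (there (there (here refl))))) = reversed
  go (there (there (there (there (there (here refl)))))) =
    SameSubspace-trans reversed (InSpan-swap b (a ⊕ b))

module _ {x y : V} (indep : LinIndep2 x y) where
  private
    true≢false : ¬ (true ≡ false)
    true≢false ()

  LinIndep2⇒≢0ˡ : x ≢ 0v
  LinIndep2⇒≢0ˡ x≡0 = true≢false (proj₁ (indep true false (trans (⊕-identityʳ x) x≡0)))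

  LinIndep2⇒≢0ʳ : y ≢ 0v
  LinIndep2⇒≢0ʳ y≡0 = true≢false (proj₂ (indep false true (trans (⊕-identityˡ y) y≡0)))

  LinIndep2⇒≢ : x ≢ y
  LinIndep2⇒≢ refl = true≢false (proj₁ (indep true true (⊕-self x)))

  -- Independence rules out zero vectors and equal vectors, so of the sixteen pairs from the span
  -- only the six listed ones survive.
  InSpan⇒∈-orderedBases : ∀ {a b} → InSpan a b x → InSpan a b y → (x , y) ∈ orderedBases a b
  InSpan⇒∈-orderedBases (inj₁ x≡0) _ = contradiction x≡0 LinIndep2⇒≢0ˡ
  InSpan⇒∈-orderedBases _ (inj₁ y≡0) = contradiction y≡0 LinIndep2⇒≢0ʳ
  InSpan⇒∈-orderedBases (inj₂ (inj₁ refl)) (inj₂ (inj₁ refl)) = contradiction refl LinIndep2⇒≢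
  InSpan⇒∈-orderedBases (inj₂ (inj₁ refl)) (inj₂ (inj₂ (inj₁ refl))) = here refl
  InSpan⇒∈-orderedBases (inj₂ (inj₁ refl)) (inj₂ (inj₂ (inj₂ refl))) = there (there (here refl))
  InSpan⇒∈-orderedBases (inj₂ (inj₂ (inj₁ refl))) (inj₂ (inj₁ refl)) = there (here refl)
  InSpan⇒∈-orderedBases (inj₂ (inj₂ (inj₁ refl))) (inj₂ (inj₂ (inj₁ refl))) =
    contradiction refl LinIndep2⇒≢
  InSpan⇒∈-orderedBases (inj₂ (inj₂ (inj₁ refl))) (inj₂ (inj₂ (inj₂ refl))) =
    there (there (there (there (here refl))))
  InSpan⇒∈-orderedBases (inj₂ (inj₂ (inj₂ refl))) (inj₂ (inj₁ refl)) =
    there (there (there (here refl)))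
  InSpan⇒∈-orderedBases (inj₂ (inj₂ (inj₂ refl))) (inj₂ (inj₂ (inj₁ refl))) =
    there (there (there (there (there (here refl)))))
  InSpan⇒∈-orderedBases (inj₂ (inj₂ (inj₂ refl))) (inj₂ (inj₂ (inj₂ refl))) =
    contradiction refl LinIndep2⇒≢

  SameSubspace⇒∈-orderedBases : ∀ {a b} → SameSubspace (InSpan x y) (InSpan a b) →
    (x , y) ∈ orderedBases a b
  SameSubspace⇒∈-orderedBases h =
    InSpan⇒∈-orderedBases (to (h x) (inj₂ (inj₁ refl))) (to (h y) (inj₂ (inj₂ (inj₁ refl))))

triangleBases : Triple → List (V × V)
triangleBases (a , b , c) = orderedBases a b ++ orderedBases b c ++ orderedBases c a

∈-triangleBases⇒TriContains : ∀ {x y} t → (x , y) ∈ triangleBases t → TriContains (InSpan x y) t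
∈-triangleBases⇒TriContains (a , b , c) p with ∈-++⁻ (orderedBases a b) p
... | inj₁ q = inj₁ (∈-orderedBases⇒SameSubspace q)
... | inj₂ q with ∈-++⁻ (orderedBases b c) q
...   | inj₁ r = inj₂ (inj₁ (∈-orderedBases⇒SameSubspace r))
...   | inj₂ r = inj₂ (inj₂ (∈-orderedBases⇒SameSubspace r))

TriContains⇒∈-triangleBases : ∀ {x y} t → LinIndep2 x y → TriContains (InSpan x y) t →
  (x , y) ∈ triangleBases t
TriContains⇒∈-triangleBases (a , b , c) indep (inj₁ h) =
  ∈-++⁺ˡ (SameSubspace⇒∈-orderedBases indep h)
TriContains⇒∈-triangleBases (a , b , c) indep (inj₂ (inj₁ h)) =
  ∈-++⁺ʳ (orderedBases a b) (∈-++⁺ˡ (SameSubspace⇒∈-orderedBases indep h))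
TriContains⇒∈-triangleBases (a , b , c) indep (inj₂ (inj₂ h)) =
  ∈-++⁺ʳ (orderedBases a b) (∈-++⁺ʳ (orderedBases b c) (SameSubspace⇒∈-orderedBases indep h))

_≟V²_ : DecidableEquality (V × V)
_≟V²_ = ×-≡-dec _≟V_ _≟V_

open DecMembership _≟V_ using () renaming (_∈?_ to _∈V?_)
open DecMembership _≟V²_ using () renaming (_∈?_ to _∈V²?_)

LinIndep2? : ∀ a b → Dec (LinIndep2 a b)
LinIndep2? a b = ∀Bool? λ e₁ → ∀Bool? λ e₂ →
  ((scale e₁ a ⊕ scale e₂ b) ≟V 0v) →-dec ((e₁ ≟B false) ×-dec (e₂ ≟B false))

LinIndep3? : ∀ a b c → Dec (LinIndep3 a b c)
LinIndep3? a b c = ∀Bool? λ e₁ → ∀Bool? λ e₂ → ∀Bool? λ e₃ →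
  ((scale e₁ a ⊕ scale e₂ b ⊕ scale e₃ c) ≟V 0v) →-dec
  ((e₁ ≟B false) ×-dec ((e₂ ≟B false) ×-dec (e₃ ≟B false)))

-- The subfield F_4 and the Desarguesian spread

1v : V
1v = true ∷ false ∷ false ∷ false ∷ false ∷ false ∷ []

α^_ : ℕ → V
α^_ = iterate mulX 1v

-- Since `α` has order 63, this is a primitive cube root of unity, so it generates the
-- multiplicative group of F_4.
ω : V
ω = α^ 21

F4 : List V
F4 = 0v ∷ 1v ∷ ω ∷ 1v ⊕ ω ∷ []

InF4⇒∈F4 : ∀ z → InF4 z → z ∈ F4
InF4⇒∈F4 = toWitness
  {a? = ∀Vec? λ z → (((z · z) · (z · z)) ≟V z) →-dec (z ∈V? F4)} _

0v-· : ∀ v → 0v · v ≡ 0v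
0v-· = toWitness {a? = ∀Vec? λ v → (0v · v) ≟V 0v} _

1v-· : ∀ v → 1v · v ≡ v
1v-· = toWitness {a? = ∀Vec? λ v → (1v · v) ≟V v} _

-- The only instance of distributivity that the description of F_4-lines requires.
1+ω-· : ∀ v → (1v ⊕ ω) · v ≡ v ⊕ ω · v
1+ω-· = toWitness {a? = ∀Vec? λ v → ((1v ⊕ ω) · v) ≟V (v ⊕ ω · v)} _

F4Line-span : ∀ v → SameSubspace (F4Line v) (InSpan v (ω · v))
F4Line-span v z = mk⇔
  (λ { (l , l∈F4 , refl) → fwd (InF4⇒∈F4 l l∈F4) })
  (λ { (inj₁ refl)                 → 0v , refl , sym (0v-· v)
     ; (inj₂ (inj₁ refl))          → 1v , refl , sym (1v-· v)
     ; (inj₂ (inj₂ (inj₁ refl)))   → ω , refl , refl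
     ; (inj₂ (inj₂ (inj₂ refl)))   → 1v ⊕ ω , refl , sym (1+ω-· v) })
  where
  fwd : ∀ {l} → l ∈ F4 → InSpan v (ω · v) (l · v)
  fwd (here refl)                         = inj₁ (0v-· v)
  fwd (there (here refl))                 = inj₂ (inj₁ (1v-· v))
  fwd (there (there (here refl)))         = inj₂ (inj₂ (inj₁ refl))
  fwd (there (there (there (here refl)))) = inj₂ (inj₂ (inj₂ (1+ω-· v)))

F4Line-refl : ∀ v → F4Line v v
F4Line-refl v = 1v , refl , sym (1v-· v)

F4Line-LinIndep2 : ∀ v → v ≢ 0v → LinIndep2 v (ω · v)
F4Line-LinIndep2 = toWitness
  {a? = ∀Vec? λ v → ¬? (v ≟V 0v) →-dec LinIndep2? v (ω · v)} _

-- As ω² = 1 + ω, multiplication by `ω` permutes the three listed vectors cyclically, so each of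
-- them followed by its `ω`-multiple is again a basis of the same line when `w` is nonzero.
F4Line-basis : ∀ w → ListAll.All (λ x → (x , ω · x) ∈ orderedBases w (ω · w))
                                  (w ∷ ω · w ∷ w ⊕ ω · w ∷ [])
F4Line-basis = toWitness
  {a? = ∀Vec? λ w → ListAll.all? (λ x → (x , ω · x) ∈V²? orderedBases w (ω · w)) _} _

-- Any nonzero point of an F_4-line generates it, which is why distinct lines of the spread meet
-- only in zero.
F4Line-≡ : ∀ {w x} → x ≢ 0v → F4Line w x → SameSubspace (F4Line w) (F4Line x)
F4Line-≡ {w} {x} x≢0 x∈w =
  SameSubspace-trans (F4Line-span w)
    (SameSubspace-trans (SameSubspace-sym (∈-orderedBases⇒SameSubspace (basis (to (F4Line-span w x) x∈w))))
      (SameSubspace-sym (F4Line-span x)))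
  where
  basis : InSpan w (ω · w) x → (x , ω · x) ∈ orderedBases w (ω · w)
  basis (inj₁ x≡0) = contradiction x≡0 x≢0
  basis (inj₂ (inj₁ refl)) = ListAll.lookup (F4Line-basis w) (here refl)
  basis (inj₂ (inj₂ (inj₁ refl))) = ListAll.lookup (F4Line-basis w) (there (here refl))
  basis (inj₂ (inj₂ (inj₂ refl))) = ListAll.lookup (F4Line-basis w) (there (there (here refl)))

isSpread : IsSpread
isSpread =
  (λ v v≢0 → v , ω · v , F4Line-LinIndep2 v v≢0 , F4Line-span v) ,
  (λ x x≢0 → x , x≢0 , F4Line-refl x , λ w _ x∈w → F4Line-≡ x≢0 x∈w)

-- The multiples of `x` by the elements of F_4 outside F_2. For independent `x` and `y` this is a
-- decidable substitute for `InGroupSet (InSpan x y)`.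
F4Multiple : V → V → Set
F4Multiple x y = y ∈ ω · x ∷ x ⊕ ω · x ∷ []

F4Multiple? : ∀ x y → Dec (F4Multiple x y)
F4Multiple? x y = y ∈V? _

InGroupSet⇒F4Multiple : ∀ {x y} → LinIndep2 x y → InGroupSet (InSpan x y) → F4Multiple x y
InGroupSet⇒F4Multiple indep (v , _ , h) = ListAll.lookup (F4Multiple-bases v)
  (SameSubspace⇒∈-orderedBases indep (SameSubspace-trans h (F4Line-span v)))
  where
  F4Multiple-bases : ∀ v → ListAll.All (λ p → F4Multiple (proj₁ p) (proj₂ p)) (orderedBases v (ω · v))
  F4Multiple-bases = toWitness
    {a? = ∀Vec? λ v → ListAll.all? (λ p → F4Multiple? (proj₁ p) (proj₂ p)) (orderedBases v (ω · v))} _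

F4Multiple⇒InGroupSet : ∀ {x y} → LinIndep2 x y → F4Multiple x y → InGroupSet (InSpan x y)
F4Multiple⇒InGroupSet {x} {y} indep m =
  x , LinIndep2⇒≢0ˡ indep ,
  SameSubspace-trans (∈-orderedBases⇒SameSubspace (basis m)) (SameSubspace-sym (F4Line-span x))
  where
  basis : F4Multiple x y → (x , y) ∈ orderedBases x (ω · x)
  basis (here refl)         = here refl
  basis (there (here refl)) = there (there (here refl))

-- Designs from an index of ordered bases

allValid? : ∀ B → Dec (All ValidTriangle B)
allValid? B = Fin.all? λ j → LinIndep3? _ _ _

module _ (B : List Triple) (index : V → V → Maybe (Fin (length B))) where

  -- The uniqueness half: a basis occurring in two blocks would have two indices.
  Indexes : Set
  Indexes = ∀ i → ListAll.All (λ p → index (proj₁ p) (proj₂ p) ≡ just i) (triangleBases (lookup B i))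

  -- A missing index marks the lines of the spread.
  Located : V → V → Maybe (Fin (length B)) → Set
  Located x y (just i) = (x , y) ∈ triangleBases (lookup B i) × ¬ F4Multiple x y
  Located x y nothing  = F4Multiple x y

  -- The existence half. Over F_2 a pair is dependent exactly in the first three cases, which are
  -- exempted.
  LocatesAll : Set
  LocatesAll = ∀ x y → x ≡ 0v ⊎ y ≡ 0v ⊎ x ≡ y ⊎ Located x y (index x y)

  indexes? : Dec Indexes
  indexes? = Fin.all? λ i → ListAll.all?
    (λ p → Maybe.≡-dec Fin._≟_ (index (proj₁ p) (proj₂ p)) (just i)) (triangleBases (lookup B i))

  located? : ∀ x y m → Dec (Located x y m)
  located? x y (just i) = ((x , y) ∈V²? triangleBases (lookup B i)) ×-dec ¬? (F4Multiple? x y)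
  located? x y nothing  = F4Multiple? x y

  locatesAll? : Dec LocatesAll
  locatesAll? = ∀Vec? λ x → ∀Vec? λ y →
    (x ≟V 0v) ⊎-dec ((y ≟V 0v) ⊎-dec ((x ≟V y) ⊎-dec located? x y (index x y)))

  indexed⇒IsGDTD : All ValidTriangle B → Indexes → LocatesAll → IsGDTD B
  indexed⇒IsGDTD valid indexes locatesAll = valid , lines
    where
    index-unique : ∀ {x y} → LinIndep2 x y → ∀ j → TriContains (InSpan x y) (lookup B j) →
      index x y ≡ just j
    index-unique indep j c =
      ListAll.lookup (indexes j) (TriContains⇒∈-triangleBases (lookup B j) indep c)

    lines : (x y : V) → LinIndep2 x y →
         (ExactlyOne (TriContains (InSpan x y)) B × ¬ InGroupSet (InSpan x y))
       ⊎ (NoneOf (TriContains (InSpan x y)) B × InGroupSet (InSpan x y))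
    -- Abstracting `index-unique indep` along with `index x y` makes its equation speak of the value
    -- found.
    lines x y indep with index x y | index-unique indep | locatesAll x y
    ... | _      | _      | inj₁ x≡0 = contradiction x≡0 (LinIndep2⇒≢0ˡ indep)
    ... | _      | _      | inj₂ (inj₁ y≡0) = contradiction y≡0 (LinIndep2⇒≢0ʳ indep)
    ... | _      | _      | inj₂ (inj₂ (inj₁ x≡y)) = contradiction x≡y (LinIndep2⇒≢ indep)
    ... | just i | unique | inj₂ (inj₂ (inj₂ (p , ¬m))) =
      inj₁ ((i , ∈-triangleBases⇒TriContains (lookup B i) p ,
             λ j c → sym (Maybe.just-injective (unique j c))) ,
            ¬m ∘ InGroupSet⇒F4Multiple indep)
    -- A block containing this plane would force `nothing ≡ just j`.
    ... | nothing | unique | inj₂ (inj₂ (inj₂ m)) =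
      inj₂ ((λ j c → contradiction (unique j c) λ ()) , F4Multiple⇒InGroupSet indep m)

-- Binary tries as lookup tables

Trie : Set → ℕ → Set
Trie A zero    = A
Trie A (suc n) = Trie A n × Trie A n

module _ {A : Set} where
  constant : ∀ {n} → A → Trie A n
  constant {zero}  a = a
  constant {suc n} a = constant a , constant a

  find : ∀ {n} → Trie A n → Vec Bool n → A
  find t []                = t
  find (t , _) (false ∷ v) = find t v
  find (_ , t) (true  ∷ v) = find t v

  insert : ∀ {n} → Vec Bool n → A → Trie A n → Trie A n
  insert []          a _       = a
  insert (false ∷ v) a (s , t) = insert v a s , t
  insert (true  ∷ v) a (s , t) = s , insert v a t

-- The key is the 12-bit concatenation of the two basis vectors, so a lookup takes twelve steps
-- instead of a search through 210 · 18 bases. If blocks shared a basis, one entry would overwrite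
-- another and `Indexes` would fail.
basisTrie : (B : List Triple) → Trie (Maybe (Fin (length B))) 12
basisTrie B = foldr
  (λ i t → foldr (λ p → insert (proj₁ p ++ᵛ proj₂ p) (just i)) t (triangleBases (lookup B i)))
  (constant nothing) (allFin (length B))

-- The blocks and their verification

-- Exponents of α, found by computer search.
baseTriangles : List (ℕ × ℕ × ℕ)
baseTriangles =
  (0 , 8 , 53) ∷ (1 , 35 , 59) ∷ (0 , 5 , 38) ∷ (1 , 29 , 41) ∷ (0 , 6 , 35) ∷
  (1 , 14 , 40) ∷ (0 , 25 , 34) ∷ (0 , 4 , 37) ∷ (0 , 7 , 18) ∷ (0 , 10 , 33) ∷ []

-- Adding 3s to the exponents multiplies a triangle by α^{3s}; α³ has order 21, hence the range of
-- `s`. Exponents beyond 62 stay unreduced, as α^63 = 1.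
blocks : List Triple
blocks = concatMap
  (λ { (i , j , k) → map (λ s → α^ (3 * s + i) , α^ (3 * s + j) , α^ (3 * s + k)) (upTo 21) })
  baseTriangles

trieIndex : ∀ {A} → Trie A 12 → V → V → A
trieIndex t x y = find t (x ++ᵛ y)

-- The trie is passed as an argument, not unfolded inside the index function, so
-- that the type checker evaluates it only once.
blocks-indexes : Indexes blocks (trieIndex (basisTrie blocks))
blocks-indexes = toWitness {a? = indexes? blocks (trieIndex (basisTrie blocks))} _

blocks-locatesAll : LocatesAll blocks (trieIndex (basisTrie blocks))
blocks-locatesAll = toWitness {a? = locatesAll? blocks (trieIndex (basisTrie blocks))} _

blocks-valid : All ValidTriangle blocks
blocks-valid = toWitness {a? = allValid? blocks} _

-- 20 = 210 · 6 / 63, since a triangle covers six nonzero vectors.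
coverCount-blocks : ∀ x → x ≢ 0v → coverCount blocks x ≡ 20
coverCount-blocks = toWitness {a? = coverCount≡20? blocks} _
  where
  coverCount≡20? : ∀ B → Dec (∀ x → x ≢ 0v → coverCount B x ≡ 20)
  coverCount≡20? B = ∀Vec? λ x → ¬? (x ≟V 0v) →-dec (coverCount B x ℕ.≟ 20)

theorem4 : IsSpread × Σ (List Triple) (λ B → IsGDTD B × Balanced B)
theorem4 =
  isSpread , blocks ,
  indexed⇒IsGDTD blocks (trieIndex (basisTrie blocks))
    blocks-valid blocks-indexes blocks-locatesAll ,
  20 , coverCount-blocks
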